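{- The following statements are equivalent: (1) Every bridgeless cubic graph has a 4-line Fano-flow. (2) Every bridgeless cubic graph has three 1-factors $M_1,M_2,M_3$ such that $M_1\cap M_2\cap M_3=\emptyset$. (3) Every bridgeless cubic graph has a bipartite core. (4) Every bridgeless cubic graph has a triangle-free core. (5) Every bridgeless cubic graph has three 1-factors such that the complement of their union is an acyclic graph.
   Context: A Fano-flow on a cubic graph $G$ is a map $\varphi:E(G)\to\mathbb{Z}_2^3\setminus\{0\}$ such that at every vertex the sum of the values of the three incident edges is $0$. The Fano plane has the seven nonzero elements of $\mathbb{Z}_2^3$ as points and the triples $\{a,b,c\}$ with $a+b+c=0$ as lines; at each vertex the three flow values form a line. A $k$-line Fano-flow is a Fano-flow in which at most $k$ distinct lines occur as the sets of flow values at the vertices. For three 1-factors $M_1,M_2,M_3$ of $G$ and $i\in\{0,1,2,3\}$, let $E_i$ be the set of edges lying in exactly $i$ of them; the core with respect to $M_1,M_2,M_3$ is the subgraph $G[E_0\cup E_2\cup E_3]$ formed by these edges. A core is triangle-free if it contains no circuit of length $3$. The complement of $M_1\cup M_2\cup M_3$ is the spanning subgraph $(V(G),E(G)\setminus(M_1\cup M_2\cup M_3))$, and acyclic means it contains no circuit. -}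

module Defs where

open import Data.Nat using (ℕ; zero; suc; _+_)
open import Data.Bool using (Bool; true; false; if_then_else_; not; _∨_; _xor_)
open import Data.Fin using (Fin; zero; suc; _≟_)
open import Data.Maybe using (Maybe; just; nothing; fromMaybe)
import Data.Maybe as Maybe
open import Data.Product using (Σ; ∃; ∃-syntax; _×_; _,_; proj₁; proj₂)
open import Data.Sum using (_⊎_)
open import Relation.Nullary using (¬_; does)
open import Relation.Binary.PropositionalEquality using (_≡_; _≢_)
open import Function using (_⇔_)
open import Function.Definitions using (Injective)

-- Finite multigraphs: vertices Fin n, edges Fin m, each edge has two ends
-- (loops and parallel edges are allowed).

record Graph : Set where
  field
    n    : ℕ
    m    : ℕ
    ends : Fin m → Fin n × Fin n

open Graph public

V : Graph → Set
V G = Fin (n G)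

E : Graph → Set
E G = Fin (m G)

src tgt : (G : Graph) → E G → V G
src G e = proj₁ (ends G e)
tgt G e = proj₂ (ends G e)

-- edge subsets (spanning subgraphs) as Boolean predicates on edges
EdgeSet : Graph → Set
EdgeSet G = E G → Bool

allEdges : (G : Graph) → EdgeSet G
allEdges G _ = true

Joins : (G : Graph) → E G → V G → V G → Set
Joins G e a b = (ends G e ≡ (a , b)) ⊎ (ends G e ≡ (b , a))

Incident : (G : Graph) → E G → V G → Set
Incident G e v = (src G e ≡ v) ⊎ (tgt G e ≡ v)

foldFin : ∀ {A : Set} → (A → A → A) → A → ∀ {k} → (Fin k → A) → A
foldFin _∙_ ε {zero}  f = ε
foldFin _∙_ ε {suc k} f = f zero ∙ foldFin _∙_ ε (λ i → f (suc i))

hit : ∀ {k} → Fin k → Fin k → ℕ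
hit a v = if does (a ≟ v) then 1 else 0

-- degree of v in the spanning subgraph with edge set S (a loop counts twice)
degIn : (G : Graph) → EdgeSet G → V G → ℕ
degIn G S v = foldFin _+_ 0 (λ e → if S e then hit (src G e) v + hit (tgt G e) v else 0)

Cubic : Graph → Set
Cubic G = ∀ v → degIn G (allEdges G) v ≡ 3

data Reach (G : Graph) (S : EdgeSet G) : V G → V G → Set where
  here : ∀ {a} → Reach G S a a
  step : ∀ {a b c} (e : E G) → S e ≡ true → Joins G e a b → Reach G S b c → Reach G S a c

without : (G : Graph) → E G → EdgeSet G
without G e f = not (does (f ≟ e))

IsBridge : (G : Graph) → E G → Set
IsBridge G e = ¬ Reach G (without G e) (src G e) (tgt G e)

Bridgeless : Graph → Set
Bridgeless G = ∀ e → ¬ IsBridge G e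

IsOneFactor : (G : Graph) → EdgeSet G → Set
IsOneFactor G M = ∀ v → degIn G M v ≡ 1

Z23 : Set
Z23 = Bool × Bool × Bool

0₃ : Z23
0₃ = false , false , false

_⊕_ : Z23 → Z23 → Z23
(a , b , c) ⊕ (a' , b' , c') = (a xor a') , (b xor b') , (c xor c')

-- sum of flow values over the edge-ends at v (a loop contributes twice)
flowSum : (G : Graph) → (E G → Z23) → V G → Z23
flowSum G φ v = foldFin _⊕_ 0₃
  (λ e → (if does (src G e ≟ v) then φ e else 0₃) ⊕ (if does (tgt G e ≟ v) then φ e else 0₃))

IsFanoFlow : (G : Graph) → (E G → Z23) → Set
IsFanoFlow G φ = (∀ e → φ e ≢ 0₃) × (∀ v → flowSum G φ v ≡ 0₃)

ValueAt : (G : Graph) → (E G → Z23) → V G → Z23 → Set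
ValueAt G φ v x = ∃[ e ] (Incident G e v × φ e ≡ x)

-- at most k distinct sets of values (lines) occur at the vertices:
-- there are k value-sets L₀ … L_{k-1} such that the value set at each vertex is one of them
AtMostKLines : ℕ → (G : Graph) → (E G → Z23) → Set
AtMostKLines k G φ =
  Σ (Fin k → Z23 → Bool) λ L → ∀ (v : V G) → ∃[ i ] (∀ x → ValueAt G φ v x ⇔ (L i x ≡ true))

KLineFanoFlow : ℕ → (G : Graph) → (E G → Z23) → Set
KLineFanoFlow k G φ = IsFanoFlow G φ × AtMostKLines k G φ

count3 : ∀ {G : Graph} → EdgeSet G → EdgeSet G → EdgeSet G → E G → ℕ
count3 M₁ M₂ M₃ e = b2n (M₁ e) + b2n (M₂ e) + b2n (M₃ e)
  where
  b2n : Bool → ℕ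
  b2n true = 1
  b2n false = 0

isOne : ℕ → Bool
isOne 1 = true
isOne _ = false

-- core: edges in E₀ ∪ E₂ ∪ E₃, i.e. lying in a number of Mᵢ different from 1
core : (G : Graph) → EdgeSet G → EdgeSet G → EdgeSet G → EdgeSet G
core G M₁ M₂ M₃ e = not (isOne (count3 {G} M₁ M₂ M₃ e))

complement3 : (G : Graph) → EdgeSet G → EdgeSet G → EdgeSet G → EdgeSet G
complement3 G M₁ M₂ M₃ e = not (M₁ e ∨ M₂ e ∨ M₃ e)

Bipartite : (G : Graph) → EdgeSet G → Set
Bipartite G H = Σ (V G → Bool) λ c → ∀ e → H e ≡ true → c (src G e) ≢ c (tgt G e)

stepFin : ∀ {k} → Fin (suc k) → Maybe (Fin (suc k))
stepFin {zero}  zero    = nothing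
stepFin {suc k} zero    = just (suc zero)
stepFin {suc k} (suc i) = Maybe.map suc (stepFin i)

csucc : ∀ {k} → Fin (suc k) → Fin (suc k)
csucc i = fromMaybe zero (stepFin i)

-- a circuit of length (suc k) in the subgraph with edge set H:
-- distinct vertices v₀ … v_k and distinct edges e₀ … e_k of H with
-- eᵢ joining vᵢ and v_{i+1 mod (k+1)}
Circuit : (G : Graph) → EdgeSet G → ℕ → Set
Circuit G H k =
  Σ (Fin (suc k) → V G) λ vs → Σ (Fin (suc k) → E G) λ es →
    Injective _≡_ _≡_ vs × Injective _≡_ _≡_ es ×
    (∀ i → H (es i) ≡ true × Joins G (es i) (vs i) (vs (csucc i)))

TriangleFree : (G : Graph) → EdgeSet G → Set
TriangleFree G H = ¬ Circuit G H 2

Acyclic : (G : Graph) → EdgeSet G → Set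
Acyclic G H = ∀ k → ¬ Circuit G H k

Stmt1 Stmt2 Stmt3 Stmt4 Stmt5 : Set
Stmt1 = ∀ (G : Graph) → Cubic G → Bridgeless G →
  Σ (E G → Z23) λ φ → KLineFanoFlow 4 G φ
Stmt2 = ∀ (G : Graph) → Cubic G → Bridgeless G →
  Σ (EdgeSet G) λ M₁ → Σ (EdgeSet G) λ M₂ → Σ (EdgeSet G) λ M₃ →
    IsOneFactor G M₁ × IsOneFactor G M₂ × IsOneFactor G M₃ ×
    (∀ e → ¬ (M₁ e ≡ true × M₂ e ≡ true × M₃ e ≡ true))
Stmt3 = ∀ (G : Graph) → Cubic G → Bridgeless G →
  Σ (EdgeSet G) λ M₁ → Σ (EdgeSet G) λ M₂ → Σ (EdgeSet G) λ M₃ →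
    IsOneFactor G M₁ × IsOneFactor G M₂ × IsOneFactor G M₃ ×
    Bipartite G (core G M₁ M₂ M₃)
Stmt4 = ∀ (G : Graph) → Cubic G → Bridgeless G →
  Σ (EdgeSet G) λ M₁ → Σ (EdgeSet G) λ M₂ → Σ (EdgeSet G) λ M₃ →
    IsOneFactor G M₁ × IsOneFactor G M₂ × IsOneFactor G M₃ ×
    TriangleFree G (core G M₁ M₂ M₃)
Stmt5 = ∀ (G : Graph) → Cubic G → Bridgeless G →
  Σ (EdgeSet G) λ M₁ → Σ (EdgeSet G) λ M₂ → Σ (EdgeSet G) λ M₃ →
    IsOneFactor G M₁ × IsOneFactor G M₂ × IsOneFactor G M₃ ×
    Acyclic G (complement3 G M₁ M₂ M₃)

{-# OPTIONS --safe #-}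
module Submission where

-- (1) ⇔ (2).  A Fano-flow φ and a nonzero functional f give the edge set {f ∘ φ = 0}, which is a 1-factor
-- exactly when the line ker f occurs at no vertex.  With at most four lines in use, three functionals are
-- left over.  The value p of an edge in all three 1-factors would lie on three unused lines as well as on
-- the line used at an end of the edge, but only three lines pass through p.  Conversely, the complements of
-- three 1-factors are the coordinates of a flow that does not use the kernels of the coordinate functionals.
--
-- (2) ⇒ (3), (5).  If E₃ = ∅, then E₀ and E₂ are matchings covering the same vertices.  By the Fredholm
-- alternative over ℤ₂ a non-bipartite core would contain an even subgraph with an odd number of edges;
-- but such a subgraph has equally many edges in E₀ and in E₂.
--
-- (4), (5) ⇒ (2).  Insert a diamond (K₄ minus an edge) into every edge of G.  A 1-factor contains either
-- both or none of the two edges attaching a diamond, hence induces a 1-factor of G.  If an attaching edge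
-- lies in all three 1-factors, the diamond consists of a 4-circuit in E₀ with its chord in E₃: its
-- triangles lie in the core and its 4-circuit in the complement of the union.

open import Defs
open import Algebra.Bundles using (CommutativeRing)
import Algebra.Properties.Semiring.Sum as SemiringSum
open import Algebra.Structures using (IsMonoid)
open import Data.Bool using (Bool; true; false; if_then_else_; not; _∧_; _∨_; _xor_)
open import Data.Bool.Properties using (⇔→≡; xor-assoc; xor-identityʳ; xor-same; xor-∧-commutativeRing; ∧-assoc; ∧-identityʳ; ∧-zeroʳ; ∧-distribʳ-xor; not-injective; not-involutive; ¬-not; if-eta; if-cong-then) renaming (_≟_ to _≟ᵇ_)
open import Data.Empty using (⊥)
open import Data.Fin using (Fin; zero; suc; _≟_; _↑ˡ_; _↑ʳ_; combine; remQuot; splitAt)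
open import Data.Fin.Patterns using (0F; 1F; 2F; 3F; 4F; 5F; 6F)
import Data.Fin.Properties as Fin
open import Data.List using (List; []; _∷_; _++_; map; foldr; length; tabulate; lookup)
open import Data.List.Membership.Propositional using (_∈_; _∉_)
open import Data.List.Membership.Propositional.Properties using (∈-map⁺; ∈-map⁻; ∈-++⁺ˡ; ∈-++⁺ʳ; ∈-++⁻; ∈-tabulate⁺)
import Data.List.Membership.DecPropositional as DecMembership
open import Data.List.Relation.Unary.Any using (here; there; index)
open import Data.List.Relation.Unary.Any.Properties using (lookup-index)
open import Data.Nat using (ℕ; zero; suc; _+_; _*_; _≤_; _<_; s≤s; z≤n)
import Data.Nat.Properties as ℕ
open import Data.Product using (Σ; ∃; ∃-syntax; _×_; _,_; proj₁; proj₂)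
open import Data.Product.Properties using (≡-dec)
open import Data.Sum using (_⊎_; inj₁; inj₂)
open import Function using (_⇔_; mk⇔; _∘_; Equivalence)
open import Relation.Binary using (DecidableEquality)
open import Relation.Binary.PropositionalEquality using (_≡_; _≢_; refl; sym; trans; cong; cong₂; subst; isEquivalence; module ≡-Reasoning)
open import Relation.Nullary using (¬_; Dec; yes; no; does; contradiction)
open import Relation.Nullary.Decidable using (map′; _×-dec_; _→-dec_; _⊎-dec_; ¬?; from-yes; dec-true; dec-false)

open SemiringSum (CommutativeRing.semiring xor-∧-commutativeRing) using ()
  renaming (sum to ⨁; sum-cong-≗ to ⨁-cong; ∑-distrib-+ to ⨁-distrib-xor; sum-replicate-zero to ⨁-zero
           ; *-distribˡ-sum to ∧-distribˡ-⨁; *-distribʳ-sum to ∧-distribʳ-⨁)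
open SemiringSum ℕ.+-*-semiring using (sum)
  renaming (sum-cong-≗ to sum-cong; ∑-distrib-+ to sum-distrib-+; ∑-comm to sum-comm
           ; *-distribʳ-sum to sum-distribʳ-*; sum-replicate-zero to sum-zero)

-- Exhaustive search over Bool and ℤ₂³

∀Bool? : {P : Bool → Set} → (∀ b → Dec (P b)) → Dec (∀ b → P b)
∀Bool? P? = map′ (λ { (f , t) → λ { false → f ; true → t } }) (λ p → p false , p true)
  (P? false ×-dec P? true)

∀Z23? : {P : Z23 → Set} → (∀ x → Dec (P x)) → Dec (∀ x → P x)
∀Z23? P? = map′ (λ { p (a , b , c) → p a b c }) (λ p a b c → p (a , b , c))
  (∀Bool? λ a → ∀Bool? λ b → ∀Bool? λ c → P? (a , b , c))

∃Bool? : {P : Bool → Set} → (∀ b → Dec (P b)) → Dec (∃ P)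
∃Bool? P? = map′ (λ { (inj₁ p) → false , p ; (inj₂ p) → true , p })
  (λ { (false , p) → inj₁ p ; (true , p) → inj₂ p }) (P? false ⊎-dec P? true)

∃Z23? : {P : Z23 → Set} → (∀ x → Dec (P x)) → Dec (∃ P)
∃Z23? P? = map′ (λ { (a , b , c , p) → (a , b , c) , p }) (λ { ((a , b , c) , p) → a , b , c , p })
  (∃Bool? λ a → ∃Bool? λ b → ∃Bool? λ c → P? (a , b , c))

_≟ᶻ_ : DecidableEquality Z23
_≟ᶻ_ = ≡-dec _≟ᵇ_ (≡-dec _≟ᵇ_ _≟ᵇ_)

open DecMembership _≟ᶻ_ using (_∈?_)

b2n : Bool → ℕ
b2n b = if b then 1 else 0

-- The Fano plane, with lines given by their dual vectors

dot : Z23 → Z23 → Bool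
dot (a , b , c) (a' , b' , c') = (a ∧ a') xor ((b ∧ b') xor (c ∧ c'))

-- Opaque, because unfolding exhaustive searches on symbolic arguments is exponentially expensive.
opaque
  line : Z23 → Z23 → Bool
  line g x = not (does (x ≟ᶻ 0₃)) ∧ not (dot g x)

opaque
  unfolding line

  line⇒dot : ∀ g x → line g x ≡ true → dot g x ≡ false
  line⇒dot = from-yes (∀Z23? λ g → ∀Z23? λ x → (line g x ≟ᵇ true) →-dec (dot g x ≟ᵇ false))

  line-injective : ∀ g g' → (∀ x → line g x ≡ line g' x) → g ≡ g'
  line-injective = from-yes (∀Z23? λ g → ∀Z23? λ g' →
    (∀Z23? λ x → line g x ≟ᵇ line g' x) →-dec (g ≟ᶻ g'))

zerosOf : Z23 → List Z23 → ℕ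
zerosOf f xs = foldr _+_ 0 (map (λ x → b2n (not (dot f x))) xs)

opaque
  unfolding line

  -- Since `c` is nonzero, `a` and `b` differ, so the three vectors are the nonzero elements of a
  -- plane, and `g` spans its annihilator. Any other nonzero functional stays nonzero on that plane
  -- and vanishes at exactly one of the three.
  line-through : ∀ a b c → a ≢ 0₃ → b ≢ 0₃ → c ≢ 0₃ → foldr _⊕_ 0₃ (a ∷ b ∷ c ∷ []) ≡ 0₃ → ∃[ g ]
    ( g ≢ 0₃
    × (∀ x → x ∈ a ∷ b ∷ c ∷ [] → line g x ≡ true)
    × (∀ x → line g x ≡ true → x ∈ a ∷ b ∷ c ∷ [])
    × zerosOf g (a ∷ b ∷ c ∷ []) ≡ 3
    × (∀ f → f ≢ 0₃ → f ≢ g → zerosOf f (a ∷ b ∷ c ∷ []) ≡ 1))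
  line-through = from-yes (∀Z23? λ a → ∀Z23? λ b → ∀Z23? λ c →
    ¬? (a ≟ᶻ 0₃) →-dec ¬? (b ≟ᶻ 0₃) →-dec ¬? (c ≟ᶻ 0₃) →-dec
    (foldr _⊕_ 0₃ (a ∷ b ∷ c ∷ []) ≟ᶻ 0₃) →-dec ∃Z23? λ g →
    ¬? (g ≟ᶻ 0₃)
    ×-dec (∀Z23? λ x → (x ∈? (a ∷ b ∷ c ∷ [])) →-dec (line g x ≟ᵇ true))
    ×-dec (∀Z23? λ x → (line g x ≟ᵇ true) →-dec (x ∈? (a ∷ b ∷ c ∷ [])))
    ×-dec (zerosOf g (a ∷ b ∷ c ∷ []) ℕ.≟ 3)
    ×-dec (∀Z23? λ f → ¬? (f ≟ᶻ 0₃) →-dec ¬? (f ≟ᶻ g) →-dec (zerosOf f (a ∷ b ∷ c ∷ []) ℕ.≟ 1)))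

  -- The three lines through p are f₁, f₂ and f₁ ⊕ f₂.
  lines-through-point : ∀ p f₁ f₂ f → p ≢ 0₃ → f₁ ≢ 0₃ → f₂ ≢ 0₃ → f ≢ 0₃ → f₁ ≢ f₂ → f ≢ f₁ → f ≢ f₂ →
    dot f₁ p ≡ false → dot f₂ p ≡ false → dot f p ≡ false → f ≡ f₁ ⊕ f₂
  lines-through-point = from-yes (∀Z23? λ p → ∀Z23? λ f₁ → ∀Z23? λ f₂ → ∀Z23? λ f →
    ¬? (p ≟ᶻ 0₃) →-dec ¬? (f₁ ≟ᶻ 0₃) →-dec ¬? (f₂ ≟ᶻ 0₃) →-dec ¬? (f ≟ᶻ 0₃) →-dec
    ¬? (f₁ ≟ᶻ f₂) →-dec ¬? (f ≟ᶻ f₁) →-dec ¬? (f ≟ᶻ f₂) →-dec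
    (dot f₁ p ≟ᵇ false) →-dec (dot f₂ p ≟ᵇ false) →-dec (dot f p ≟ᵇ false) →-dec (f ≟ᶻ (f₁ ⊕ f₂)))

nonzero : Fin 7 → Z23
nonzero = lookup (
  (false , false , true) ∷ (false , true , false) ∷ (false , true , true) ∷
  (true , false , false) ∷ (true , false , true) ∷ (true , true , false) ∷ (true , true , true) ∷ [])

opaque
  nonzero≢0 : ∀ i → nonzero i ≢ 0₃
  nonzero≢0 = from-yes (Fin.all? λ i → ¬? (nonzero i ≟ᶻ 0₃))

  nonzero-injective : ∀ i j → nonzero i ≡ nonzero j → i ≡ j
  nonzero-injective = from-yes (Fin.all? λ i → Fin.all? λ j → (nonzero i ≟ᶻ nonzero j) →-dec (i ≟ j))

  -- By pigeonhole, two of the seven nonzero vectors would otherwise sit at the same index of `xs`.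
  fresh : (xs : List Z23) → length xs < 7 → ∃[ y ] (y ≢ 0₃ × y ∉ xs)
  fresh xs short =
    let i , ∉xs = Fin.¬∀⟶∃¬ 7 (λ i → nonzero i ∈ xs) (λ i → nonzero i ∈? xs) ¬all
    in nonzero i , nonzero≢0 i , ∉xs
    where
    ¬all : ¬ (∀ i → nonzero i ∈ xs)
    ¬all all =
      let i , j , i<j , same = Fin.pigeonhole short (λ i → index (all i))
      in Fin.<⇒≢ i<j (nonzero-injective i j
           (trans (lookup-index (all i)) (trans (cong (lookup xs) same) (sym (lookup-index (all j))))))

⊕-isMonoid : IsMonoid _≡_ _⊕_ 0₃
⊕-isMonoid = record
  { isSemigroup = record
    { isMagma = record { isEquivalence = isEquivalence ; ∙-cong = cong₂ _⊕_ }
    ; assoc = λ { (a , b , c) (a' , b' , c') (a'' , b'' , c'') →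
        cong₂ _,_ (xor-assoc a a' a'') (cong₂ _,_ (xor-assoc b b' b'') (xor-assoc c c' c'')) } }
  ; identity = (λ _ → refl) , λ { (a , b , c) →
      cong₂ _,_ (xor-identityʳ a) (cong₂ _,_ (xor-identityʳ b) (xor-identityʳ c)) } }

-- Sums over the half-edges at a vertex

module _ {A : Set} {_∙_ : A → A → A} {ε : A} where

  foldFin-cong : ∀ {k} {f g : Fin k → A} → (∀ i → f i ≡ g i) → foldFin _∙_ ε f ≡ foldFin _∙_ ε g
  foldFin-cong {zero}  eq = refl
  foldFin-cong {suc k} eq = cong₂ _∙_ (eq zero) (foldFin-cong (eq ∘ suc))

  foldFin-hom : {B : Set} {_◦_ : B → B → B} {η : B} (h : A → B) →
    (∀ x y → h (x ∙ y) ≡ h x ◦ h y) → h ε ≡ η →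
    ∀ {k} (f : Fin k → A) → h (foldFin _∙_ ε f) ≡ foldFin _◦_ η (h ∘ f)
  foldFin-hom h h-∙ h-ε {zero}  f = h-ε
  foldFin-hom {_◦_ = _◦_} h h-∙ h-ε {suc k} f =
    trans (h-∙ _ _) (cong (h (f zero) ◦_) (foldFin-hom h h-∙ h-ε (f ∘ suc)))

∈-foldFin-++⁺ : ∀ {A : Set} {x : A} {k} (f : Fin k → List A) i → x ∈ f i → x ∈ foldFin _++_ [] f
∈-foldFin-++⁺ f zero    p = ∈-++⁺ˡ p
∈-foldFin-++⁺ f (suc i) p = ∈-++⁺ʳ (f zero) (∈-foldFin-++⁺ (f ∘ suc) i p)

∈-foldFin-++⁻ : ∀ {A : Set} {x : A} {k} (f : Fin k → List A) → x ∈ foldFin _++_ [] f → ∃[ i ] x ∈ f i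
∈-foldFin-++⁻ {k = suc k} f p with ∈-++⁻ (f zero) p
... | inj₁ q = zero , q
... | inj₂ q = let i , r = ∈-foldFin-++⁻ (f ∘ suc) q in suc i , r

-- `flowSum` has this form literally, and `degIn` after the membership test is moved inwards.
-- Allowing any operation lets concatenation produce the list of half-edges.
foldHalf : ∀ {A : Set} → (A → A → A) → A → (G : Graph) → (E G → A) → V G → A
foldHalf _∙_ ε G f v = foldFin _∙_ ε
  (λ e → (if does (src G e ≟ v) then f e else ε) ∙ (if does (tgt G e ≟ v) then f e else ε))

-- A loop is listed twice.
halfEdges : (G : Graph) → V G → List (E G)
halfEdges G = foldHalf _++_ [] G (_∷ [])

-- Lists form the free monoid: `eval` is the homomorphism extending `f`, and it carries the fold
-- that builds `halfEdges` to the fold in `A`.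
foldHalf-halfEdges : ∀ {A : Set} {_∙_ : A → A → A} {ε : A} → IsMonoid _≡_ _∙_ ε →
  ∀ G (f : E G → A) v → foldHalf _∙_ ε G f v ≡ foldr _∙_ ε (map f (halfEdges G v))
foldHalf-halfEdges {A} {_∙_} {ε} monoid G f v =
  sym (trans (foldFin-hom eval eval-++ refl {m G} _) (foldFin-cong λ e →
    trans (eval-++ (if does (src G e ≟ v) then e ∷ [] else []) _)
          (cong₂ _∙_ (eval-if (does (src G e ≟ v)) e) (eval-if (does (tgt G e ≟ v)) e))))
  where
  open IsMonoid monoid using (identityˡ; identityʳ; assoc)
  eval : List (E G) → A
  eval xs = foldr _∙_ ε (map f xs)
  eval-++ : ∀ xs ys → eval (xs ++ ys) ≡ eval xs ∙ eval ys
  eval-++ []       ys = sym (identityˡ _)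
  eval-++ (x ∷ xs) ys = trans (cong (f x ∙_) (eval-++ xs ys)) (sym (assoc _ _ _))
  eval-if : ∀ b e → eval (if b then e ∷ [] else []) ≡ (if b then f e else ε)
  eval-if true  e = identityʳ _
  eval-if false e = refl

degIn-foldHalf : ∀ G S v → degIn G S v ≡ foldHalf _+_ 0 G (b2n ∘ S) v
degIn-foldHalf G S v = foldFin-cong (λ e → bits (S e) (does (src G e ≟ v)) (does (tgt G e ≟ v)))
  where
  bits : ∀ s a b → (if s then b2n a + b2n b else 0) ≡ (if a then b2n s else 0) + (if b then b2n s else 0)
  bits false false false = refl
  bits false false true  = refl
  bits false true  false = refl
  bits false true  true  = refl
  bits true  a     b     = refl

degIn-halfEdges : ∀ G S v → degIn G S v ≡ foldr _+_ 0 (map (b2n ∘ S) (halfEdges G v))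
degIn-halfEdges G S v = trans (degIn-foldHalf G S v) (foldHalf-halfEdges ℕ.+-0-isMonoid G (b2n ∘ S) v)

flowSum-halfEdges : ∀ G φ v → flowSum G φ v ≡ foldr _⊕_ 0₃ (map φ (halfEdges G v))
flowSum-halfEdges G φ v = foldHalf-halfEdges ⊕-isMonoid G φ v

incident⇔∈halfEdges : ∀ G e v → Incident G e v ⇔ e ∈ halfEdges G v
incident⇔∈halfEdges G e v = mk⇔ to from
  where
  half : E G → List (E G)
  half f = (if does (src G f ≟ v) then f ∷ [] else []) ++ (if does (tgt G f ≟ v) then f ∷ [] else [])
  to : Incident G e v → e ∈ halfEdges G v
  to inc = ∈-foldFin-++⁺ half e (atEnd inc)
    where
    atEnd : Incident G e v → e ∈ half e
    atEnd (inj₁ p) rewrite dec-true (src G e ≟ v) p = here refl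
    atEnd (inj₂ p) rewrite dec-true (tgt G e ≟ v) p = ∈-++⁺ʳ (if does (src G e ≟ v) then e ∷ [] else []) (here refl)
  from : e ∈ halfEdges G v → Incident G e v
  from p with f , q ← ∈-foldFin-++⁻ half p with src G f ≟ v | tgt G f ≟ v | q
  ... | yes s | _     | here refl         = inj₁ s
  ... | yes _ | yes t | there (here refl) = inj₂ t
  ... | no _  | yes t | here refl         = inj₂ t

-- The degree counts half-edges, so the list has length three; a loop would occupy two of its
-- places.
cubic-halfEdges : ∀ G → Cubic G → ∀ v → ∃[ e₁ ] ∃[ e₂ ] ∃[ e₃ ] halfEdges G v ≡ e₁ ∷ e₂ ∷ e₃ ∷ []
cubic-halfEdges G cubic v = three (halfEdges G v) (trans (sym (degIn-halfEdges G (allEdges G) v)) (cubic v))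
  where
  three : ∀ xs → foldr _+_ 0 (map (λ _ → 1) xs) ≡ 3 → ∃[ e₁ ] ∃[ e₂ ] ∃[ e₃ ] xs ≡ e₁ ∷ e₂ ∷ e₃ ∷ []
  three (a ∷ b ∷ c ∷ []) _ = a , b , c , refl

degIn-three : ∀ G S v {a b c} → halfEdges G v ≡ a ∷ b ∷ c ∷ [] →
  degIn G S v ≡ b2n (S a) + (b2n (S b) + (b2n (S c) + 0))
degIn-three G S v eq = trans (degIn-halfEdges G S v) (cong (λ es → foldr _+_ 0 (map (b2n ∘ S) es)) eq)

-- Fano-flows and 1-factors

kernel : (G : Graph) → (E G → Z23) → Z23 → EdgeSet G
kernel G φ f e = not (dot f (φ e))

opaque
  lineAt : ∀ G → Cubic G → ∀ φ → IsFanoFlow G φ → ∀ v → ∃[ g ]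
    ( g ≢ 0₃
    × (∀ x → ValueAt G φ v x ⇔ (line g x ≡ true))
    × degIn G (kernel G φ g) v ≡ 3
    × (∀ f → f ≢ 0₃ → f ≢ g → degIn G (kernel G φ f) v ≡ 1))
  lineAt G cubic φ (φ≢0 , sum≡0) v =
    let a , b , c , eq = cubic-halfEdges G cubic v
        g , nz , ∈⇒line , line⇒∈ , deg₃ , deg₁ =
          line-through (φ a) (φ b) (φ c) (φ≢0 a) (φ≢0 b) (φ≢0 c)
            (trans (cong (λ es → foldr _⊕_ 0₃ (map φ es)) (sym eq)) (trans (sym (flowSum-halfEdges G φ v)) (sum≡0 v)))
        deg : ∀ f → degIn G (kernel G φ f) v ≡ zerosOf f (φ a ∷ φ b ∷ φ c ∷ [])
        deg f = degIn-three G (kernel G φ f) v eq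
    in g , nz
     , (λ x → mk⇔
         (λ (e , inc , φe≡x) → subst (λ y → line g y ≡ true) φe≡x (∈⇒line (φ e)
           (subst (λ es → φ e ∈ map φ es) eq (∈-map⁺ φ (Equivalence.to (incident⇔∈halfEdges G e v) inc)))))
         (λ on → let e , e∈ , x≡ = ∈-map⁻ φ (line⇒∈ x on) in
           e , Equivalence.from (incident⇔∈halfEdges G e v) (subst (e ∈_) (sym eq) e∈) , sym x≡))
     , trans (deg g) deg₃
     , λ f f≢0 f≢g → trans (deg f) (deg₁ f f≢0 f≢g)

opaque
  -- The sets `L i` of `AtMostKLines` are arbitrary and need not be lines, hence a search. The
  -- default `0₃` is harmless: only sets that occur at a vertex are looked up through `dualOf-line`.
  dualOf : (Z23 → Bool) → Z23
  dualOf l with ∃Z23? (λ g → ∀Z23? λ x → l x ≟ᵇ line g x)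
  ... | yes (g , _) = g
  ... | no  _       = 0₃

  dualOf-line : ∀ l g → (∀ x → l x ≡ line g x) → dualOf l ≡ g
  dualOf-line l g eq with ∃Z23? (λ g → ∀Z23? λ x → l x ≟ᵇ line g x)
  ... | yes (g' , eq') = line-injective g' g (λ x → trans (sym (eq' x)) (eq x))
  ... | no  none       = contradiction (g , eq) none

stmt1⇒2 : Stmt1 → Stmt2
stmt1⇒2 s1 G cubic bridgeless
  with φ , flow , L , onL ← s1 G cubic bridgeless
  -- Each functional avoids the listed lines and its predecessors; the lists have four, five and six
  -- entries, always fewer than the seven nonzero vectors.
  with f₁ , f₁≢0 , f₁∉ ← fresh (tabulate (dualOf ∘ L)) (from-yes (4 ℕ.<? 7))
  with f₂ , f₂≢0 , f₂∉ ← fresh (f₁ ∷ tabulate (dualOf ∘ L)) (from-yes (5 ℕ.<? 7))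
  with f₃ , f₃≢0 , f₃∉ ← fresh (f₂ ∷ f₁ ∷ tabulate (dualOf ∘ L)) (from-yes (6 ℕ.<? 7))
  = M f₁ , M f₂ , M f₃
  , factor f₁ f₁≢0 f₁∉
  , factor f₂ f₂≢0 (f₂∉ ∘ there)
  , factor f₃ f₃≢0 (f₃∉ ∘ there ∘ there)
  , λ e (p₁ , p₂ , p₃) → disjoint e (not-injective p₁) (not-injective p₂) (not-injective p₃)
  where
  M = kernel G φ
  used : List Z23
  used = tabulate (dualOf ∘ L)

  g : V G → Z23
  g v = proj₁ (lineAt G cubic φ flow v)
  g≢0 : ∀ v → g v ≢ 0₃
  g≢0 v = proj₁ (proj₂ (lineAt G cubic φ flow v))
  g-line : ∀ v x → ValueAt G φ v x ⇔ (line (g v) x ≡ true)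
  g-line v = proj₁ (proj₂ (proj₂ (lineAt G cubic φ flow v)))

  g∈used : ∀ v → g v ∈ used
  g∈used v with i , onLᵢ ← onL v = subst (_∈ used) (dualOf-line (L i) (g v) same) (∈-tabulate⁺ {f = dualOf ∘ L} i)
    where
    same : ∀ x → L i x ≡ line (g v) x
    same x = ⇔→≡ (mk⇔ (Equivalence.to (g-line v x) ∘ Equivalence.from (onLᵢ x))
                      (Equivalence.to (onLᵢ x) ∘ Equivalence.from (g-line v x)))

  factor : ∀ f → f ≢ 0₃ → f ∉ used → IsOneFactor G (M f)
  factor f f≢0 f∉ v = proj₂ (proj₂ (proj₂ (proj₂ (lineAt G cubic φ flow v)))) f f≢0
    (λ f≡g → f∉ (subst (_∈ used) (sym f≡g) (g∈used v)))

  disjoint : ∀ e → dot f₁ (φ e) ≡ false → dot f₂ (φ e) ≡ false → dot f₃ (φ e) ≡ false → ⊥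
  -- Both `g v` and `f₃` vanish at `φ e` and differ from `f₁` and `f₂`, so both equal the third line
  -- `f₁ ⊕ f₂`; but `g v` is used and `f₃` is not.
  disjoint e p₁ p₂ p₃ = f₃∉ (there (there (subst (_∈ used) (trans
      (through (g v) (g≢0 v) (avoid f₁∉) (avoid (f₂∉ ∘ there))
        (line⇒dot (g v) (φ e) (Equivalence.to (g-line v (φ e)) (e , inj₁ refl , refl))))
      (sym (through f₃ f₃≢0 (λ eq → f₃∉ (there (here eq))) (λ eq → f₃∉ (here eq)) p₃))) (g∈used v))))
    where
    v = src G e
    avoid : ∀ {f} → f ∉ used → g v ≢ f
    avoid f∉ eq = f∉ (subst (_∈ used) eq (g∈used v))
    through : ∀ f → f ≢ 0₃ → f ≢ f₁ → f ≢ f₂ → dot f (φ e) ≡ false → f ≡ f₁ ⊕ f₂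
    through f f≢0 f≢f₁ f≢f₂ = lines-through-point (φ e) f₁ f₂ f (proj₁ flow e) f₁≢0 f₂≢0 f≢0
      (λ eq → f₂∉ (here (sym eq))) f≢f₁ f≢f₂ p₁ p₂

-- Duals of the four lines that are not the kernel of a coordinate functional.
nonUnits : Fin 4 → Z23
nonUnits = lookup ((false , true , true) ∷ (true , false , true) ∷ (true , true , false) ∷ (true , true , true) ∷ [])

opaque
  nonUnits-complete : ∀ g → g ≢ 0₃ →
    g ≢ (true , false , false) → g ≢ (false , true , false) → g ≢ (false , false , true) →
    ∃[ i ] nonUnits i ≡ g
  nonUnits-complete = from-yes (∀Z23? λ g → ¬? (g ≟ᶻ 0₃) →-dec
    ¬? (g ≟ᶻ (true , false , false)) →-dec ¬? (g ≟ᶻ (false , true , false)) →-dec ¬? (g ≟ᶻ (false , false , true)) →-dec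
    Fin.any? (λ i → nonUnits i ≟ᶻ g))

stmt2⇒1 : Stmt2 → Stmt1
stmt2⇒1 s2 G cubic bridgeless
  with M₁ , M₂ , M₃ , F₁ , F₂ , F₃ , disjoint ← s2 G cubic bridgeless
  = φ , flow , line ∘ nonUnits , fourLines
  where
  -- The complement of a 1-factor has degree two everywhere, so every coordinate is a flow; all
  -- three vanish only on an edge common to the 1-factors.
  φ : E G → Z23
  φ e = not (M₁ e) , not (M₂ e) , not (M₃ e)

  parity : ∀ M → IsOneFactor G M → ∀ v {a b c} → halfEdges G v ≡ a ∷ b ∷ c ∷ [] →
    not (M a) xor (not (M b) xor (not (M c) xor false)) ≡ false
  parity M F v {a} {b} {c} eq = odd (M a) (M b) (M c) (trans (sym (degIn-three G M v eq)) (F v))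
    where
    odd : ∀ a b c → b2n a + (b2n b + (b2n c + 0)) ≡ 1 → not a xor (not b xor (not c xor false)) ≡ false
    odd = from-yes (∀Bool? λ a → ∀Bool? λ b → ∀Bool? λ c →
      (b2n a + (b2n b + (b2n c + 0)) ℕ.≟ 1) →-dec (not a xor (not b xor (not c xor false)) ≟ᵇ false))

  flow : IsFanoFlow G φ
  flow = (λ e eq → disjoint e (not-injective (cong proj₁ eq) , not-injective (cong (proj₁ ∘ proj₂) eq)
                              , not-injective (cong (proj₂ ∘ proj₂) eq)))
       , λ v → let a , b , c , eq = cubic-halfEdges G cubic v in
           trans (flowSum-halfEdges G φ v) (trans (cong (λ xs → foldr _⊕_ 0₃ (map φ xs)) eq)
             (cong₂ _,_ (parity M₁ F₁ v eq) (cong₂ _,_ (parity M₂ F₂ v eq) (parity M₃ F₃ v eq))))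

  coordinate : ∀ b → not (not b xor false) ≡ b
  coordinate b = trans (cong not (xor-identityʳ (not b))) (not-involutive b)

  -- If the line at `v` were the kernel of the coordinate belonging to `M`, all three half-edges at
  -- `v` would lie in `M`.
  unit : ∀ u M v → IsOneFactor G M → (∀ e → kernel G φ u e ≡ M e) → ¬ (degIn G (kernel G φ u) v ≡ 3)
  unit u M v F same deg₃ with () ← trans (sym deg₃) (trans
    (foldFin-cong λ e → cong (λ s → if s then hit (src G e) v + hit (tgt G e) v else 0) (same e)) (F v))

  fourLines : ∀ v → ∃[ i ] (∀ x → ValueAt G φ v x ⇔ (line (nonUnits i) x ≡ true))
  fourLines v =
    let g , g≢0 , onLine , deg₃ , _ = lineAt G cubic φ flow v
        excluded : ∀ u M → IsOneFactor G M → (∀ e → kernel G φ u e ≡ M e) → g ≢ u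
        excluded u M F same g≡u = unit u M v F same (subst (λ h → degIn G (kernel G φ h) v ≡ 3) g≡u deg₃)
        i , eq = nonUnits-complete g g≢0
          (excluded (true , false , false) M₁ F₁ (λ e → coordinate (M₁ e)))
          (excluded (false , true , false) M₂ F₂ (λ e → coordinate (M₂ e)))
          (excluded (false , false , true) M₃ F₃ (λ e → not-involutive (M₃ e)))
    in i , λ x → subst (λ h → ValueAt G φ v x ⇔ (line h x ≡ true)) (sym eq) (onLine x)

foldFin-xor : ∀ {k} (f : Fin k → Bool) → foldFin _xor_ false f ≡ ⨁ f
foldFin-xor {zero}  f = refl
foldFin-xor {suc k} f = cong (f zero xor_) (foldFin-xor (f ∘ suc))

foldFin-+ : ∀ {k} (f : Fin k → ℕ) → foldFin _+_ 0 f ≡ sum f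
foldFin-+ {zero}  f = refl
foldFin-+ {suc k} f = cong (f zero +_) (foldFin-+ (f ∘ suc))

-- Linear algebra over ℤ₂

δ : ∀ {k} → Fin k → Fin k → Bool
δ i j = does (i ≟ j)

⨁-false : ∀ {k} {f : Fin k → Bool} → (∀ i → f i ≡ false) → ⨁ f ≡ false
⨁-false {k} eq = trans (⨁-cong eq) (⨁-zero k)

⨁-δ : ∀ {k} (i : Fin k) (f : Fin k → Bool) → ⨁ (λ j → δ i j ∧ f j) ≡ f i
⨁-δ {suc k} zero f = trans (cong (f zero xor_) (⨁-zero k)) (xor-identityʳ (f zero))
⨁-δ (suc i) f = ⨁-δ i (f ∘ suc)

∧-expand : ∀ a c d x → (a xor (c ∧ d)) ∧ x ≡ (a ∧ x) xor (c ∧ (d ∧ x))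
∧-expand a c d x = trans (∧-distribʳ-xor x a (c ∧ d)) (cong ((a ∧ x) xor_) (∧-assoc c d x))

-- Gaussian elimination, one column at a time. With no columns left, a row with right-hand side
-- `true` is contradictory, and its indicator is the certificate.
fredholm : ∀ n {m} (A : Fin m → Fin n → Bool) (b : Fin m → Bool) →
  (Σ (Fin n → Bool) λ x → ∀ i → ⨁ (λ j → A i j ∧ x j) ≡ b i)
  ⊎ (Σ (Fin m → Bool) λ y → (∀ j → ⨁ (λ i → y i ∧ A i j) ≡ false) × ⨁ (λ i → y i ∧ b i) ≡ true)
fredholm zero A b with Fin.any? (λ i → b i ≟ᵇ true)
... | yes (i , bᵢ) = inj₂ (δ i , (λ ()) , trans (⨁-δ i b) bᵢ)
... | no  none     = inj₁ ((λ ()) , λ i → sym (¬-not (λ bᵢ → none (i , bᵢ))))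
fredholm (suc n) A b with Fin.any? (λ i → A i zero ≟ᵇ true)
... | no none with fredholm n (λ i j → A i (suc j)) b
...   | inj₁ (x , sol) = inj₁ ((λ { zero → false ; (suc j) → x j }) , λ i →
        trans (cong (_xor ⨁ (λ j → A i (suc j) ∧ x j)) (∧-zeroʳ (A i zero))) (sol i))
...   | inj₂ (y , ortho , odd) = inj₂ (y , (λ { zero → ⨁-false λ i →
          trans (cong (y i ∧_) (¬-not (λ a → none (i , a)))) (∧-zeroʳ (y i))
        ; (suc j) → ortho j }) , odd)
-- Otherwise row p is a pivot: subtract it from every row with a nonzero entry in column 0.
fredholm (suc n) {m} A b | yes (p , Aₚ) with fredholm n (λ i j → A i (suc j) xor (A i zero ∧ A p (suc j))) (λ i → b i xor (A i zero ∧ b p))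
... | inj₁ (x , sol) = inj₁ (x' , solves)
  where
  -- The pivot equation, solved for the eliminated unknown.
  x₀ = b p xor ⨁ (λ j → A p (suc j) ∧ x j)
  x' : Fin (suc n) → Bool
  x' zero    = x₀
  x' (suc j) = x j
  R : Fin m → Bool
  R i = ⨁ (λ j → A i (suc j) ∧ x j)
  reduced : ∀ i → R i xor (A i zero ∧ R p) ≡ b i xor (A i zero ∧ b p)
  reduced i = trans (sym (trans
    (⨁-cong λ j → ∧-expand (A i (suc j)) (A i zero) (A p (suc j)) (x j))
    (trans (⨁-distrib-xor (λ j → A i (suc j) ∧ x j) (λ j → A i zero ∧ (A p (suc j) ∧ x j)))
      (cong (R i xor_) (sym (∧-distribˡ-⨁ (A i zero) (λ j → A p (suc j) ∧ x j))))))) (sol i)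
  solves : ∀ i → (A i zero ∧ x₀) xor R i ≡ b i
  solves i = bits (A i zero) (b p) (R p) (R i) (b i) (reduced i)
    where
    bits : ∀ a β ρ r β' → r xor (a ∧ ρ) ≡ β' xor (a ∧ β) → (a ∧ (β xor ρ)) xor r ≡ β'
    bits = from-yes (∀Bool? λ a → ∀Bool? λ β → ∀Bool? λ ρ → ∀Bool? λ r → ∀Bool? λ β' →
      ((r xor (a ∧ ρ)) ≟ᵇ (β' xor (a ∧ β))) →-dec (((a ∧ (β xor ρ)) xor r) ≟ᵇ β'))
... | inj₂ (y , ortho , odd) = inj₂ (y' , (λ { zero → ortho₀ ; (suc j) → trans (transfer (λ i → A i (suc j))) (ortho j) }) , trans (transfer b) odd)
  where
  C = ⨁ (λ i → y i ∧ A i zero)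
  -- Each reduced row `i` contains `A i zero` copies of row `p`; rewriting a combination `y` of
  -- reduced rows in the original rows adds `C` to the coefficient of row `p`.
  y' : Fin m → Bool
  y' i = y i xor (δ p i ∧ C)
  expand : ∀ f → ⨁ (λ i → y' i ∧ f i) ≡ ⨁ (λ i → y i ∧ f i) xor (C ∧ f p)
  expand f = trans (⨁-cong λ i → ∧-expand (y i) (δ p i) C (f i))
    (trans (⨁-distrib-xor (λ i → y i ∧ f i) (λ i → δ p i ∧ (C ∧ f i)))
      (cong (⨁ (λ i → y i ∧ f i) xor_) (⨁-δ p (λ i → C ∧ f i))))
  transfer : ∀ f → ⨁ (λ i → y' i ∧ f i) ≡ ⨁ (λ i → y i ∧ (f i xor (A i zero ∧ f p)))
  transfer f = trans (expand f) (sym (trans (⨁-cong λ i → bits (y i) (f i) (A i zero) (f p))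
    (trans (⨁-distrib-xor (λ i → y i ∧ f i) (λ i → (y i ∧ A i zero) ∧ f p))
      (cong (⨁ (λ i → y i ∧ f i) xor_) (sym (∧-distribʳ-⨁ (f p) (λ i → y i ∧ A i zero)))))))
    where
    bits : ∀ y f a g → y ∧ (f xor (a ∧ g)) ≡ (y ∧ f) xor ((y ∧ a) ∧ g)
    bits = from-yes (∀Bool? λ y → ∀Bool? λ f → ∀Bool? λ a → ∀Bool? λ g →
      (y ∧ (f xor (a ∧ g))) ≟ᵇ ((y ∧ f) xor ((y ∧ a) ∧ g)))
  ortho₀ : ⨁ (λ i → y' i ∧ A i zero) ≡ false
  ortho₀ = trans (expand (λ i → A i zero)) (trans (cong (λ a → C xor (C ∧ a)) Aₚ) (trans (cong (C xor_) (∧-identityʳ C)) (xor-same C)))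

-- Double counting

size : ∀ G → EdgeSet G → ℕ
size G S = sum (b2n ∘ S)

sum-hit : ∀ {k} (a : Fin k) → sum (hit a) ≡ 1
sum-hit {suc k} zero    = cong suc (sum-zero k)
sum-hit {suc k} (suc a) = sum-hit a

-- The two summations are exchanged: an edge of `S` contributes one at each end, and a loop two at
-- its only vertex.
handshake : ∀ G S → sum (degIn G S) ≡ size G S * 2
handshake G S = begin
  sum (degIn G S)
    ≡⟨ sum-cong (λ v → foldFin-+ (λ e → if S e then hit (src G e) v + hit (tgt G e) v else 0)) ⟩
  sum (λ v → sum (λ e → if S e then hit (src G e) v + hit (tgt G e) v else 0))
    ≡⟨ sum-comm {n G} {m G} (λ v e → if S e then hit (src G e) v + hit (tgt G e) v else 0) ⟩
  sum (λ e → sum (λ v → if S e then hit (src G e) v + hit (tgt G e) v else 0))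
    ≡⟨ sum-cong column ⟩
  sum (λ e → b2n (S e) * 2)
    ≡⟨ sym (sum-distribʳ-* 2 (b2n ∘ S)) ⟩
  size G S * 2 ∎
  where
  open ≡-Reasoning
  column : ∀ e → sum (λ v → if S e then hit (src G e) v + hit (tgt G e) v else 0) ≡ b2n (S e) * 2
  column e with S e
  ... | true  = trans (sum-distrib-+ (hit (src G e)) (hit (tgt G e)))
                  (cong₂ _+_ (sum-hit (src G e)) (sum-hit (tgt G e)))
  ... | false = sum-zero (n G)

odd : ℕ → Bool
odd zero    = false
odd (suc k) = not (odd k)

odd-size : ∀ {k} (S : Fin k → Bool) → ⨁ S ≡ odd (sum (b2n ∘ S))
odd-size {zero}  S = refl
odd-size {suc k} S with S zero
... | true  = cong not (odd-size (S ∘ suc))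
... | false = odd-size (S ∘ suc)

-- Two-colourings

xor-isMonoid : IsMonoid _≡_ _xor_ false
xor-isMonoid = CommutativeRing.+-isMonoid xor-∧-commutativeRing

-- A proper colouring solves the system `c (src G e) xor c (tgt G e) ≡ true` for `e` in `H`; the
-- rows of other edges are zeroed and read `false ≡ false`. A certificate of insolvability, cut down
-- to `H`, is orthogonal to every column, that is, even at every vertex, and has odd size.
bipartite-or-odd : ∀ G H → Bipartite G H ⊎ Σ (EdgeSet G) λ Y →
  ( (∀ e → H e ≡ false → Y e ≡ false)
  × (∀ v → foldr _xor_ false (map Y (halfEdges G v)) ≡ false)
  × ⨁ Y ≡ true)
bipartite-or-odd G H with fredholm (n G) (λ e v → H e ∧ (δ (src G e) v xor δ (tgt G e) v)) H
... | inj₁ (c , sol) = inj₁ (c , λ e He same → differ (c (src G e)) (c (tgt G e))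
        (trans (sym (trans (⨁-cong λ v → bits (H e) (δ (src G e) v) (δ (tgt G e) v) (c v) He)
                 (trans (⨁-distrib-xor (λ v → δ (src G e) v ∧ c v) (λ v → δ (tgt G e) v ∧ c v))
                   (cong₂ _xor_ (⨁-δ (src G e) c) (⨁-δ (tgt G e) c)))))
               (trans (sol e) He)) same)
  where
  bits : ∀ h s t c → h ≡ true → (h ∧ (s xor t)) ∧ c ≡ (s ∧ c) xor (t ∧ c)
  bits = from-yes (∀Bool? λ h → ∀Bool? λ s → ∀Bool? λ t → ∀Bool? λ c → (h ≟ᵇ true) →-dec
    (((h ∧ (s xor t)) ∧ c) ≟ᵇ ((s ∧ c) xor (t ∧ c))))
  differ : ∀ a b → a xor b ≡ true → a ≢ b
  differ a .a eq refl with () ← trans (sym eq) (xor-same a)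
... | inj₂ (y , ortho , odd) = inj₂
  ( (λ e → y e ∧ H e)
  , (λ e He → trans (cong (y e ∧_) He) (∧-zeroʳ (y e)))
  , (λ v → trans (sym (foldHalf-halfEdges xor-isMonoid G (λ e → y e ∧ H e) v))
      (trans (foldFin-xor (λ e → (if does (src G e ≟ v) then y e ∧ H e else false) xor (if does (tgt G e ≟ v) then y e ∧ H e else false)))
        (trans (⨁-cong λ e → bits (y e) (H e) (δ (src G e) v) (δ (tgt G e) v)) (ortho v))))
  , odd)
  where
  bits : ∀ y h s t → (if s then y ∧ h else false) xor (if t then y ∧ h else false) ≡ y ∧ (h ∧ (s xor t))
  bits = from-yes (∀Bool? λ y → ∀Bool? λ h → ∀Bool? λ s → ∀Bool? λ t →
    ((if s then y ∧ h else false) xor (if t then y ∧ h else false)) ≟ᵇ (y ∧ (h ∧ (s xor t))))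

-- Three 1-factors without a common edge

-- Here `Z23` merely records which of the three 1-factors contain an edge. Once `111₃` is excluded,
-- `majority` singles out the edges in exactly two of them.
missed majority inCore : Z23 → Bool
missed   (a , b , c) = not (a ∨ b ∨ c)
majority (a , b , c) = (a ∧ b) ∨ (a ∧ c) ∨ (b ∧ c)
inCore   (a , b , c) = not (isOne (b2n a + b2n b + b2n c))

bits³ : (Z23 → Bool) → Z23 → Z23 → Z23 → ℕ
bits³ p x y z = b2n (p x) + (b2n (p y) + (b2n (p z) + 0))

111₃ : Z23
111₃ = true , true , true

FactorTriple : Z23 → Z23 → Z23 → Set
FactorTriple x y z = (x ≢ 111₃ × y ≢ 111₃ × z ≢ 111₃)
  × bits³ proj₁ x y z ≡ 1 × bits³ (proj₁ ∘ proj₂) x y z ≡ 1 × bits³ (proj₂ ∘ proj₂) x y z ≡ 1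

factorTriple? : ∀ x y z → Dec (FactorTriple x y z)
factorTriple? x y z = (¬? (x ≟ᶻ 111₃) ×-dec ¬? (y ≟ᶻ 111₃) ×-dec ¬? (z ≟ᶻ 111₃))
  ×-dec (bits³ proj₁ x y z ℕ.≟ 1) ×-dec (bits³ (proj₁ ∘ proj₂) x y z ℕ.≟ 1) ×-dec (bits³ (proj₂ ∘ proj₂) x y z ℕ.≟ 1)

opaque
  -- The 1-factors account for three incidences at a vertex, and no half-edge absorbs all three, so
  -- at least two half-edges are covered.
  missed≤1 : ∀ x y z → FactorTriple x y z → bits³ missed x y z ≤ 1
  missed≤1 = from-yes (∀Z23? λ x → ∀Z23? λ y → ∀Z23? λ z → factorTriple? x y z →-dec (bits³ missed x y z ℕ.≤? 1))

  -- An even subgraph of the core uses, at each vertex, as many missed as doubly covered edges.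
  even-balanced : ∀ x y z → FactorTriple x y z → ∀ a b c →
    (inCore x ≡ false → a ≡ false) → (inCore y ≡ false → b ≡ false) → (inCore z ≡ false → c ≡ false) →
    a xor (b xor (c xor false)) ≡ false →
    b2n (a ∧ missed x) + (b2n (b ∧ missed y) + (b2n (c ∧ missed z) + 0))
    ≡ b2n (a ∧ majority x) + (b2n (b ∧ majority y) + (b2n (c ∧ majority z) + 0))
  even-balanced = from-yes (∀Z23? λ x → ∀Z23? λ y → ∀Z23? λ z → factorTriple? x y z →-dec
    (∀Bool? λ a → ∀Bool? λ b → ∀Bool? λ c →
    ((inCore x ≟ᵇ false) →-dec (a ≟ᵇ false)) →-dec
    ((inCore y ≟ᵇ false) →-dec (b ≟ᵇ false)) →-dec
    ((inCore z ≟ᵇ false) →-dec (c ≟ᵇ false)) →-dec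
    ((a xor (b xor (c xor false))) ≟ᵇ false) →-dec
    ((b2n (a ∧ missed x) + (b2n (b ∧ missed y) + (b2n (c ∧ missed z) + 0))) ℕ.≟
     (b2n (a ∧ majority x) + (b2n (b ∧ majority y) + (b2n (c ∧ majority z) + 0))))))

  core-split : ∀ x a → x ≢ 111₃ → (inCore x ≡ false → a ≡ false) → a ≡ (a ∧ missed x) xor (a ∧ majority x)
  core-split = from-yes (∀Z23? λ x → ∀Bool? λ a → ¬? (x ≟ᶻ 111₃) →-dec
    ((inCore x ≟ᵇ false) →-dec (a ≟ᵇ false)) →-dec (a ≟ᵇ ((a ∧ missed x) xor (a ∧ majority x))))

module DisjointFactors (G : Graph) (cubic : Cubic G) (M₁ M₂ M₃ : EdgeSet G)
  (F₁ : IsOneFactor G M₁) (F₂ : IsOneFactor G M₂) (F₃ : IsOneFactor G M₃)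
  (disjoint : ∀ e → ¬ (M₁ e ≡ true × M₂ e ≡ true × M₃ e ≡ true)) where

  type : E G → Z23
  type e = M₁ e , M₂ e , M₃ e

  type≢111 : ∀ e → type e ≢ 111₃
  type≢111 e eq = disjoint e (cong proj₁ eq , cong (proj₁ ∘ proj₂) eq , cong (proj₂ ∘ proj₂) eq)

  factorTriple : ∀ {v a b c} → halfEdges G v ≡ a ∷ b ∷ c ∷ [] → FactorTriple (type a) (type b) (type c)
  factorTriple {v} {a} {b} {c} eq = (type≢111 a , type≢111 b , type≢111 c)
    , trans (sym (degIn-three G M₁ v eq)) (F₁ v)
    , trans (sym (degIn-three G M₂ v eq)) (F₂ v)
    , trans (sym (degIn-three G M₃ v eq)) (F₃ v)

  degIn-complement≤1 : ∀ v → degIn G (complement3 G M₁ M₂ M₃) v ≤ 1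
  degIn-complement≤1 v = let a , b , c , eq = cubic-halfEdges G cubic v in
    subst (_≤ 1) (sym (degIn-three G (complement3 G M₁ M₂ M₃) v eq))
      (missed≤1 (type a) (type b) (type c) (factorTriple eq))

  core≡inCore : ∀ e → core G M₁ M₂ M₃ e ≡ inCore (type e)
  core≡inCore e with M₁ e | M₂ e | M₃ e
  ... | false | false | false = refl
  ... | false | false | true  = refl
  ... | false | true  | false = refl
  ... | false | true  | true  = refl
  ... | true  | false | false = refl
  ... | true  | false | true  = refl
  ... | true  | true  | false = refl
  ... | true  | true  | true  = refl

  -- An odd even-degree subgraph `Y` of the core is the disjoint union of `Y₀` and `Y₂`. These have
  -- equal degrees everywhere, hence equal sizes, which contradicts the odd size of `Y`.
  core-bipartite : Bipartite G (core G M₁ M₂ M₃)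
  core-bipartite with bipartite-or-odd G (core G M₁ M₂ M₃)
  ... | inj₁ bip = bip
  ... | inj₂ (Y , Y⊆core , even , odd-Y) = contradiction (trans (sym odd-Y) even-Y) λ ()
    where
    off-core : ∀ e → inCore (type e) ≡ false → Y e ≡ false
    off-core e eq = Y⊆core e (trans (core≡inCore e) eq)

    Y₀ Y₂ : EdgeSet G
    Y₀ e = Y e ∧ missed (type e)
    Y₂ e = Y e ∧ majority (type e)

    -- The covering numbers at a vertex are 1, 1, 1 or 0, 1, 2. So the core has there either no
    -- edge, or one missed and one doubly covered edge, and evenness makes `Y` take both or neither.
    same-degree : ∀ v → degIn G Y₀ v ≡ degIn G Y₂ v
    same-degree v = let a , b , c , eq = cubic-halfEdges G cubic v in
      trans (degIn-three G Y₀ v eq) (trans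
        (even-balanced (type a) (type b) (type c) (factorTriple eq) (Y a) (Y b) (Y c)
          (off-core a) (off-core b) (off-core c)
          (trans (cong (λ es → foldr _xor_ false (map Y es)) (sym eq)) (even v)))
        (sym (degIn-three G Y₂ v eq)))

    same-size : size G Y₀ ≡ size G Y₂
    same-size = ℕ.*-cancelʳ-≡ _ _ 2
      (trans (sym (handshake G Y₀)) (trans (sum-cong same-degree) (handshake G Y₂)))

    even-Y : ⨁ Y ≡ false
    even-Y = begin
      ⨁ Y
        ≡⟨ ⨁-cong (λ e → core-split (type e) (Y e) (type≢111 e) (off-core e)) ⟩
      ⨁ (λ e → Y₀ e xor Y₂ e)
        ≡⟨ ⨁-distrib-xor Y₀ Y₂ ⟩
      ⨁ Y₀ xor ⨁ Y₂
        ≡⟨ cong₂ _xor_ (trans (odd-size Y₀) (cong odd same-size)) (odd-size Y₂) ⟩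
      odd (size G Y₂) xor odd (size G Y₂)
        ≡⟨ xor-same (odd (size G Y₂)) ⟩
      false ∎
      where open ≡-Reasoning

stmt2⇒3 : Stmt2 → Stmt3
stmt2⇒3 s2 G cubic bridgeless =
  let M₁ , M₂ , M₃ , F₁ , F₂ , F₃ , disjoint = s2 G cubic bridgeless
  in M₁ , M₂ , M₃ , F₁ , F₂ , F₃ , DisjointFactors.core-bipartite G cubic M₁ M₂ M₃ F₁ F₂ F₃ disjoint

-- Circuits in bipartite graphs and in matchings

bipartite⇒triangleFree : ∀ G H → Bipartite G H → TriangleFree G H
bipartite⇒triangleFree G H (c , proper) (vs , es , _ , _ , joins) =
  no-triple (c (vs zero)) (c (vs (suc zero))) (c (vs (suc (suc zero))))
    (edge zero) (edge (suc zero)) (edge (suc (suc zero)))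
  where
  edge : ∀ i → c (vs i) ≢ c (vs (csucc i))
  edge i eq with joins i
  ... | h , inj₁ ends≡ = proper (es i) h (trans (cong (c ∘ proj₁) ends≡) (trans eq (cong (c ∘ proj₂) (sym ends≡))))
  ... | h , inj₂ ends≡ = proper (es i) h (trans (cong (c ∘ proj₁) ends≡) (trans (sym eq) (cong (c ∘ proj₂) (sym ends≡))))
  no-triple : ∀ x y z → x ≢ y → y ≢ z → ¬ (z ≢ x)
  no-triple x y z x≢y y≢z z≢x = z≢x (trans (¬-not (y≢z ∘ sym)) (sym (¬-not x≢y)))

stmt3⇒4 : Stmt3 → Stmt4
stmt3⇒4 s3 G cubic bridgeless =
  let M₁ , M₂ , M₃ , F₁ , F₂ , F₃ , bip = s3 G cubic bridgeless
  in M₁ , M₂ , M₃ , F₁ , F₂ , F₃ , bipartite⇒triangleFree G (core G M₁ M₂ M₃) bip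

term≤foldFin : ∀ {k} (f : Fin k → ℕ) i → f i ≤ foldFin _+_ 0 f
term≤foldFin f zero    = ℕ.m≤m+n _ _
term≤foldFin f (suc i) = ℕ.≤-trans (term≤foldFin (f ∘ suc) i) (ℕ.m≤n+m _ _)

terms≤foldFin : ∀ {k} (f : Fin k → ℕ) i j → i ≢ j → f i + f j ≤ foldFin _+_ 0 f
terms≤foldFin f zero    zero    i≢j = contradiction refl i≢j
terms≤foldFin f zero    (suc j) i≢j = ℕ.+-monoʳ-≤ (f zero) (term≤foldFin (f ∘ suc) j)
terms≤foldFin f (suc i) zero    i≢j = subst (_≤ foldFin _+_ 0 f) (ℕ.+-comm (f zero) (f (suc i)))
  (ℕ.+-monoʳ-≤ (f zero) (term≤foldFin (f ∘ suc) i))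
terms≤foldFin f (suc i) (suc j) i≢j = ℕ.≤-trans (terms≤foldFin (f ∘ suc) i j (i≢j ∘ cong suc)) (ℕ.m≤n+m _ _)

hit-refl : ∀ {k} (v : Fin k) → hit v v ≡ 1
hit-refl v = cong b2n (dec-true (v ≟ v) refl)

-- Two consecutive edges of a circuit meet at `vs (suc zero)` and give it degree at least two. Index
-- zero means length one: the circuit is a loop, which alone counts twice.
matching⇒acyclic : ∀ G H → (∀ v → degIn G H v ≤ 1) → Acyclic G H
matching⇒acyclic G H deg≤1 k (vs , es , _ , es-inj , joins) = go k vs es es-inj joins
  where
  weight : V G → E G → ℕ
  weight v e = if H e then hit (src G e) v + hit (tgt G e) v else 0

  1≤weight : ∀ {v u e} → H e ≡ true → Joins G e u v → 1 ≤ weight v e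
  1≤weight {v} {u} {e} h (inj₁ eq) rewrite h | eq | hit-refl v = ℕ.m≤n+m 1 _
  1≤weight {v} {u} {e} h (inj₂ eq) rewrite h | eq | hit-refl v = s≤s z≤n

  swap : ∀ {e u v} → Joins G e u v → Joins G e v u
  swap (inj₁ eq) = inj₂ eq
  swap (inj₂ eq) = inj₁ eq

  loop : ∀ {v e} → H e ≡ true → ends G e ≡ (v , v) → 2 ≤ weight v e
  loop {v} {e} h eq rewrite h | eq | hit-refl v = ℕ.≤-refl

  go : ∀ k (vs : Fin (suc k) → V G) (es : Fin (suc k) → E G) → (∀ {i j} → es i ≡ es j → i ≡ j) →
    ¬ (∀ i → H (es i) ≡ true × Joins G (es i) (vs i) (vs (csucc i)))
  go zero vs es es-inj joins with joins zero
  ... | h , inj₁ eq = contradiction (deg≤1 (vs zero))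
        (ℕ.<⇒≱ (ℕ.≤-trans (loop h eq) (term≤foldFin (weight (vs zero)) (es zero))))
  ... | h , inj₂ eq = contradiction (deg≤1 (vs zero))
        (ℕ.<⇒≱ (ℕ.≤-trans (loop h eq) (term≤foldFin (weight (vs zero)) (es zero))))
  go (suc k) vs es es-inj joins =
    let h₀ , j₀ = joins zero
        h₁ , j₁ = joins (suc zero)
        v = vs (suc zero)
    in contradiction (deg≤1 v) (ℕ.<⇒≱ (ℕ.≤-trans
         (ℕ.+-mono-≤ (1≤weight h₀ j₀) (1≤weight h₁ (swap j₁)))
         (terms≤foldFin (weight v) (es zero) (es (suc zero)) (λ eq → Fin.0≢1+n (es-inj eq)))))

stmt2⇒5 : Stmt2 → Stmt5
stmt2⇒5 s2 G cubic bridgeless =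
  let M₁ , M₂ , M₃ , F₁ , F₂ , F₃ , disjoint = s2 G cubic bridgeless
  in M₁ , M₂ , M₃ , F₁ , F₂ , F₃ , matching⇒acyclic G (complement3 G M₁ M₂ M₃)
       (DisjointFactors.degIn-complement≤1 G cubic M₁ M₂ M₃ F₁ F₂ F₃ disjoint)

-- Sums over disjoint unions and products of index sets

foldFin-+-cong : ∀ {k} {f g : Fin k → ℕ} → (∀ i → f i ≡ g i) → foldFin _+_ 0 f ≡ foldFin _+_ 0 g
foldFin-+-cong = foldFin-cong

if0-cong : ∀ b {x y : ℕ} → x ≡ y → (if b then x else 0) ≡ (if b then y else 0)
if0-cong b = if-cong-then b

foldFin-↑ : ∀ k {l} (f : Fin (k + l) → ℕ) →
  foldFin _+_ 0 f ≡ foldFin _+_ 0 (λ i → f (i ↑ˡ l)) + foldFin _+_ 0 (λ i → f (k ↑ʳ i))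
foldFin-↑ zero    f = refl
foldFin-↑ (suc k) f = trans (cong (f zero +_) (foldFin-↑ k (f ∘ suc))) (sym (ℕ.+-assoc (f zero) _ _))

foldFin-combine : ∀ l {k} (f : Fin (l * k) → ℕ) →
  foldFin _+_ 0 f ≡ foldFin _+_ 0 (λ (i : Fin l) → foldFin _+_ 0 (λ (j : Fin k) → f (combine i j)))
foldFin-combine zero        f = refl
foldFin-combine (suc l) {k} f = trans (foldFin-↑ k f) (cong (foldFin _+_ 0 (λ j → f (j ↑ˡ (l * k))) +_) (foldFin-combine l (f ∘ (k ↑ʳ_))))

foldFin-zero : ∀ {k} (f : Fin k → ℕ) → (∀ i → f i ≡ 0) → foldFin _+_ 0 f ≡ 0
foldFin-zero {zero}  f f≡0 = refl
foldFin-zero {suc k} f f≡0 = cong₂ _+_ (f≡0 zero) (foldFin-zero (f ∘ suc) (f≡0 ∘ suc))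

foldFin-single : ∀ {k} (f : Fin k → ℕ) i → (∀ j → j ≢ i → f j ≡ 0) → foldFin _+_ 0 f ≡ f i
foldFin-single f zero f≡0 =
  trans (cong (f zero +_) (foldFin-zero (f ∘ suc) (λ j → f≡0 (suc j) (λ ())))) (ℕ.+-identityʳ (f zero))
foldFin-single f (suc i) f≡0 =
  cong₂ _+_ (f≡0 zero λ ()) (foldFin-single (f ∘ suc) i (λ j j≢i → f≡0 (suc j) (j≢i ∘ Fin.suc-injective)))

hit-injective : ∀ {k l} {f : Fin k → Fin l} → (∀ {a b} → f a ≡ f b → a ≡ b) → ∀ a b → hit (f a) (f b) ≡ hit a b
hit-injective {f = f} inj a b with a ≟ b
... | yes refl = hit-refl (f a)
... | no  a≢b  = cong b2n (dec-false (f a ≟ f b) (a≢b ∘ inj))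

hit-≢ : ∀ {k} {a b : Fin k} → a ≢ b → hit a b ≡ 0
hit-≢ {a = a} {b} a≢b = cong b2n (dec-false (a ≟ b) a≢b)

↑ˡ≢↑ʳ : ∀ {k l} (i : Fin k) (j : Fin l) → i ↑ˡ l ≢ k ↑ʳ j
↑ˡ≢↑ʳ {k} {l} i j eq with () ← trans (sym (Fin.splitAt-↑ˡ k i l)) (trans (cong (splitAt k) eq) (Fin.splitAt-↑ʳ k l j))

-- Inserting a diamond into every edge

data Site : Set where
  source target : Site
  inner         : Fin 4 → Site

-- The 4-cycle 0 1 2 3 with chord 1 3; vertices 0 and 2 are attached to the ends of the old edge.
siteEnds : Fin 7 → Site × Site
siteEnds 0F = source  , inner 0F
siteEnds 1F = inner 2F , target
siteEnds 2F = inner 0F , inner 1F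
siteEnds 3F = inner 1F , inner 2F
siteEnds 4F = inner 2F , inner 3F
siteEnds 5F = inner 3F , inner 0F
siteEnds 6F = inner 1F , inner 3F

module Diamonds (G : Graph) where

  old : V G → Fin (n G + m G * 4)
  old v = v ↑ˡ (m G * 4)

  new : E G → Fin 4 → Fin (n G + m G * 4)
  new e k = n G ↑ʳ combine e k

  place : E G → Site → Fin (n G + m G * 4)
  place e source    = old (src G e)
  place e target    = old (tgt G e)
  place e (inner k) = new e k

  placeEnds : E G × Fin 7 → Fin (n G + m G * 4) × Fin (n G + m G * 4)
  placeEnds (e , j) = place e (proj₁ (siteEnds j)) , place e (proj₂ (siteEnds j))

  G◇ : Graph
  G◇ = record { n = n G + m G * 4 ; m = m G * 7 ; ends = placeEnds ∘ remQuot 7 }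

  edge : E G → Fin 7 → E G◇
  edge = combine

  ends-edge : ∀ e j → ends G◇ (edge e j) ≡ placeEnds (e , j)
  ends-edge e j = cong placeEnds (Fin.remQuot-combine e j)

  new-injective : ∀ {e k e' k'} → new e k ≡ new e' k' → e ≡ e' × k ≡ k'
  new-injective {e} {k} {e'} {k'} eq = Fin.combine-injective e k e' k' (Fin.↑ʳ-injective (n G) _ _ eq)

  edge-injective : ∀ {e j e' j'} → edge e j ≡ edge e' j' → e ≡ e' × j ≡ j'
  edge-injective {e} {j} {e'} {j'} = Fin.combine-injective e j e' j'

  -- The edges are grouped by the old edge they replace; `h` lets each use substitute its own
  -- simplified form of the vertex comparisons.
  degIn-◇ : ∀ S v (h : E G → Site → ℕ) → (∀ e s → hit (place e s) v ≡ h e s) →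
    degIn G◇ S v ≡ foldFin _+_ 0 (λ e → foldFin _+_ 0 (λ j →
      if S (edge e j) then h e (proj₁ (siteEnds j)) + h e (proj₂ (siteEnds j)) else 0))
  degIn-◇ S v h hit≡h = trans (foldFin-combine (m G) _) (foldFin-+-cong λ e → foldFin-+-cong λ j →
    if0-cong (S (edge e j)) (trans
      (cong (λ p → hit (proj₁ p) v + hit (proj₂ p) v) (ends-edge e j))
      (cong₂ _+_ (hit≡h e (proj₁ (siteEnds j))) (hit≡h e (proj₂ (siteEnds j))))))

  hitOld : V G → E G → Site → ℕ
  hitOld v e source    = hit (src G e) v
  hitOld v e target    = hit (tgt G e) v
  hitOld v e (inner _) = 0

  hit-old : ∀ v e s → hit (place e s) (old v) ≡ hitOld v e s
  hit-old v e source    = hit-injective (λ {a} {b} → Fin.↑ˡ-injective (m G * 4) a b) (src G e) v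
  hit-old v e target    = hit-injective (λ {a} {b} → Fin.↑ˡ-injective (m G * 4) a b) (tgt G e) v
  hit-old v e (inner k) = hit-≢ (λ eq → ↑ˡ≢↑ʳ v (combine e k) (sym eq))

  degIn-old : ∀ S v → degIn G◇ S (old v) ≡
    foldFin _+_ 0 (λ e → (if S (edge e 0F) then hit (src G e) v else 0) + (if S (edge e 1F) then hit (tgt G e) v else 0))
  degIn-old S v = trans (degIn-◇ S (old v) (hitOld v) (hit-old v)) (foldFin-+-cong local)
    where
    local : ∀ e → foldFin _+_ 0 (λ j →
      if S (edge e j) then hitOld v e (proj₁ (siteEnds j)) + hitOld v e (proj₂ (siteEnds j)) else 0)
      ≡ (if S (edge e 0F) then hit (src G e) v else 0) + (if S (edge e 1F) then hit (tgt G e) v else 0)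
    local e rewrite if-eta (S (edge e 2F)) {0} | if-eta (S (edge e 3F)) {0} | if-eta (S (edge e 4F)) {0}
      | if-eta (S (edge e 5F)) {0} | if-eta (S (edge e 6F)) {0}
      | ℕ.+-identityʳ (hit (src G e) v) | ℕ.+-identityʳ (if S (edge e 1F) then hit (tgt G e) v else 0) = refl

  hitInner : Fin 4 → Site → ℕ
  hitInner k source     = 0
  hitInner k target     = 0
  hitInner k (inner k') = hit k' k

  innerDegree : (Fin 7 → Bool) → Fin 4 → ℕ
  innerDegree s k = foldFin _+_ 0 (λ j →
    if s j then hitInner k (proj₁ (siteEnds j)) + hitInner k (proj₂ (siteEnds j)) else 0)

  -- The edges replacing other old edges do not reach `new e k`, so its degree depends on seven bits
  -- only. This is what makes the search in `through-diamond` finite.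
  degIn-new : ∀ S e k → degIn G◇ S (new e k) ≡ innerDegree (S ∘ edge e) k
  degIn-new S e k = trans (degIn-◇ S (new e k) (λ f s → hit (place f s) (new e k)) (λ _ _ → refl))
    (trans (foldFin-single _ e away) (foldFin-+-cong λ j →
      if0-cong (S (edge e j)) (cong₂ _+_ (here-hit (proj₁ (siteEnds j))) (here-hit (proj₂ (siteEnds j))))))
    where
    here-hit : ∀ s → hit (place e s) (new e k) ≡ hitInner k s
    here-hit source     = hit-≢ (↑ˡ≢↑ʳ (src G e) (combine e k))
    here-hit target     = hit-≢ (↑ˡ≢↑ʳ (tgt G e) (combine e k))
    here-hit (inner k') = hit-injective (proj₂ ∘ new-injective) k' k
    away-hit : ∀ f → f ≢ e → ∀ s → hit (place f s) (new e k) ≡ 0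
    away-hit f f≢e source     = hit-≢ (↑ˡ≢↑ʳ (src G f) (combine e k))
    away-hit f f≢e target     = hit-≢ (↑ˡ≢↑ʳ (tgt G f) (combine e k))
    away-hit f f≢e (inner k') = hit-≢ (f≢e ∘ proj₁ ∘ new-injective)
    away : ∀ f → f ≢ e → foldFin _+_ 0 (λ j → if S (edge f j)
      then hit (place f (proj₁ (siteEnds j))) (new e k) + hit (place f (proj₂ (siteEnds j))) (new e k) else 0) ≡ 0
    away f f≢e = foldFin-zero _ λ j → trans
      (if0-cong (S (edge f j)) (cong₂ _+_ (away-hit f f≢e (proj₁ (siteEnds j))) (away-hit f f≢e (proj₂ (siteEnds j)))))
      (if-eta (S (edge f j)))

  data VertexView : V G◇ → Set where
    isOld : ∀ v → VertexView (old v)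
    isNew : ∀ e k → VertexView (new e k)

  vertexView : ∀ x → VertexView x
  vertexView x with splitAt (n G) x in eq
  ... | inj₁ v = subst VertexView (Fin.splitAt⁻¹-↑ˡ eq) (isOld v)
  ... | inj₂ p = let e , k , combine≡p = Fin.combine-surjective {m G} {4} p in
    subst VertexView (trans (cong (n G ↑ʳ_) combine≡p) (Fin.splitAt⁻¹-↑ʳ eq)) (isNew e k)

  cubic◇ : Cubic G → Cubic G◇
  cubic◇ cubic x with vertexView x
  -- With all edges present, the right-hand side of `degIn-old` computes to the degree of `v` in
  -- `G`.
  ... | isOld v    = trans (degIn-old (allEdges G◇) v) (cubic v)
  ... | isNew e 0F = degIn-new (allEdges G◇) e 0F
  ... | isNew e 1F = degIn-new (allEdges G◇) e 1F
  ... | isNew e 2F = degIn-new (allEdges G◇) e 2F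
  ... | isNew e 3F = degIn-new (allEdges G◇) e 3F

  -- Bridgelessness of the enlarged graph

  without-≢ : ∀ {H : Graph} {e f : E H} → f ≢ e → without H e f ≡ true
  without-≢ {e = e} {f} f≢e = cong not (dec-false (f ≟ e) f≢e)

  module _ {S : EdgeSet G◇} where

    forward : ∀ e j → S (edge e j) ≡ true → ∀ {c} →
      Reach G◇ S (place e (proj₂ (siteEnds j))) c → Reach G◇ S (place e (proj₁ (siteEnds j))) c
    forward e j s = step (edge e j) s (inj₁ (ends-edge e j))

    backward : ∀ e j → S (edge e j) ≡ true → ∀ {c} →
      Reach G◇ S (place e (proj₁ (siteEnds j))) c → Reach G◇ S (place e (proj₂ (siteEnds j))) c
    backward e j s = step (edge e j) s (inj₂ (ends-edge e j))

  append : ∀ {H S a b c} → Reach H S a b → Reach H S b c → Reach H S a c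
  append here           q = q
  append (step e s j p) q = step e s j (append p q)

  -- Every edge `f` of the walk is replaced by the path through the inner vertices 0, 1, 2 of its
  -- own diamond. As `f` differs from `e`, this path avoids `edge e j` for every `j`.
  lift : ∀ e j {a b} → Reach G (without G e) a b → Reach G◇ (without G◇ (edge e j)) (old a) (old b)
  lift e j here = here
  lift e j (step {b = b} f f≠e joins p) = cross joins (lift e j p)
    where
    f≢e : f ≢ e
    f≢e refl with () ← trans (sym f≠e) (cong not (dec-true (f ≟ f) refl))
    avoids : ∀ i → without G◇ (edge e j) (edge f i) ≡ true
    avoids i = without-≢ {G◇} (f≢e ∘ proj₁ ∘ edge-injective)
    cross : ∀ {a b c} → Joins G f a b → Reach G◇ (without G◇ (edge e j)) (old b) c →
      Reach G◇ (without G◇ (edge e j)) (old a) c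
    cross (inj₁ eq) q rewrite sym (cong proj₁ eq) | sym (cong proj₂ eq) =
      forward f 0F (avoids 0F) (forward f 2F (avoids 2F) (forward f 3F (avoids 3F) (forward f 1F (avoids 1F) q)))
    cross (inj₂ eq) q rewrite sym (cong proj₁ eq) | sym (cong proj₂ eq) =
      backward f 1F (avoids 1F) (backward f 3F (avoids 3F) (backward f 2F (avoids 2F) (backward f 0F (avoids 0F) q)))

  -- An attaching edge is bypassed by the rest of its diamond together with a lifted walk around `e`
  -- in `G`. Each of the other five edges lies in a triangle of the diamond.
  bridgeless◇ : Bridgeless G → Bridgeless G◇
  bridgeless◇ bridgeless x with Fin.combine-surjective {m G} {7} x
  -- Bridgelessness yields a walk only under a double negation, which suffices because the goal is
  -- itself a negation.
  ... | e , j , refl = λ bridge → bridgeless e (λ p → bridge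
          (subst (λ (a , b) → Reach G◇ (without G◇ (edge e j)) a b) (sym (ends-edge e j)) (detour j p)))
    where
    S : Fin 7 → EdgeSet G◇
    S j = without G◇ (edge e j)
    avoids : ∀ {i j} → i ≢ j → S j (edge e i) ≡ true
    avoids i≢j = without-≢ {G◇} (i≢j ∘ proj₂ ∘ edge-injective)
    detour : ∀ j → Reach G (without G e) (src G e) (tgt G e) →
      Reach G◇ (S j) (place e (proj₁ (siteEnds j))) (place e (proj₂ (siteEnds j)))
    detour 0F p = append (lift e 0F p) (backward e 1F (avoids λ ()) (backward e 3F (avoids λ ()) (backward e 2F (avoids λ ()) here)))
    detour 1F p = backward e 3F (avoids λ ()) (backward e 2F (avoids λ ()) (backward e 0F (avoids λ ()) (lift e 1F p)))
    detour 2F _ = backward e 5F (avoids λ ()) (backward e 6F (avoids λ ()) here)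
    detour 3F _ = forward e 6F (avoids λ ()) (backward e 4F (avoids λ ()) here)
    detour 4F _ = backward e 3F (avoids λ ()) (forward e 6F (avoids λ ()) here)
    detour 5F _ = backward e 6F (avoids λ ()) (backward e 2F (avoids λ ()) here)
    detour 6F _ = forward e 3F (avoids λ ()) (forward e 4F (avoids λ ()) here)

  -- 1-factors of the enlarged graph

  contract : EdgeSet G◇ → EdgeSet G
  contract M e = M (edge e 0F)

  -- Edges inside the diamond cover an even number of its four vertices, so a 1-factor takes both
  -- attaching edges or neither; hence `contract` may consult just one of them. If both are taken,
  -- vertices 1 and 3 remain and must be matched by the chord.
  through-diamond : ∀ M → IsOneFactor G◇ M → ∀ e → M (edge e 1F) ≡ M (edge e 0F)
    × (M (edge e 0F) ≡ true → M (edge e 2F) ≡ false × M (edge e 3F) ≡ false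
       × M (edge e 4F) ≡ false × M (edge e 5F) ≡ false × M (edge e 6F) ≡ true)
  through-diamond M F e = bits (M (edge e 0F)) (M (edge e 1F)) (M (edge e 2F)) (M (edge e 3F))
    (M (edge e 4F)) (M (edge e 5F)) (M (edge e 6F))
    (deg 0F) (deg 1F) (deg 2F) (deg 3F)
    where
    deg : ∀ k → innerDegree (M ∘ edge e) k ≡ 1
    deg k = trans (sym (degIn-new M e k)) (F (new e k))
    seven : (a b c d e f g : Bool) → Fin 7 → Bool
    seven a b c d e f g = λ { 0F → a ; 1F → b ; 2F → c ; 3F → d ; 4F → e ; 5F → f ; 6F → g }
    bits : ∀ a b c d e f g → (let s = seven a b c d e f g) →
      innerDegree s 0F ≡ 1 → innerDegree s 1F ≡ 1 → innerDegree s 2F ≡ 1 → innerDegree s 3F ≡ 1 →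
      b ≡ a × (a ≡ true → c ≡ false × d ≡ false × e ≡ false × f ≡ false × g ≡ true)
    bits = from-yes (∀Bool? λ a → ∀Bool? λ b → ∀Bool? λ c → ∀Bool? λ d → ∀Bool? λ e → ∀Bool? λ f → ∀Bool? λ g →
      let s = seven a b c d e f g in
      (innerDegree s 0F ℕ.≟ 1) →-dec (innerDegree s 1F ℕ.≟ 1) →-dec (innerDegree s 2F ℕ.≟ 1) →-dec (innerDegree s 3F ℕ.≟ 1) →-dec
      (b ≟ᵇ a) ×-dec ((a ≟ᵇ true) →-dec (c ≟ᵇ false) ×-dec (d ≟ᵇ false) ×-dec (e ≟ᵇ false) ×-dec (f ≟ᵇ false) ×-dec (g ≟ᵇ true)))

  contract-oneFactor : ∀ M → IsOneFactor G◇ M → IsOneFactor G (contract M)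
  contract-oneFactor M F v = trans (foldFin-+-cong λ e → sym (trans
      (cong (λ b → (if M (edge e 0F) then hit (src G e) v else 0) + (if b then hit (tgt G e) v else 0))
            (proj₁ (through-diamond M F e)))
      (merge (M (edge e 0F)))))
    (trans (sym (degIn-old M v)) (F (old v)))
    where
    merge : ∀ b {x y} → (if b then x else 0) + (if b then y else 0) ≡ (if b then x + y else 0)
    merge true  = refl
    merge false = refl

  module _ {M₁ M₂ M₃ : EdgeSet G◇} (F₁ : IsOneFactor G◇ M₁) (F₂ : IsOneFactor G◇ M₂) (F₃ : IsOneFactor G◇ M₃)
    (e : E G) (common : contract M₁ e ≡ true × contract M₂ e ≡ true × contract M₃ e ≡ true) where

    private
      u₁ = proj₂ (through-diamond M₁ F₁ e) (proj₁ common)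
      u₂ = proj₂ (through-diamond M₂ F₂ e) (proj₁ (proj₂ common))
      u₃ = proj₂ (through-diamond M₃ F₃ e) (proj₂ (proj₂ common))

    -- The triangle on the inner vertices 0, 1, 3. Its sides `2F` and `5F` lie in no 1-factor and
    -- the chord `6F` in all three; neither count is one.
    core-triangle : Circuit G◇ (core G◇ M₁ M₂ M₃) 2
    core-triangle = new e ∘ corner , edge e ∘ side
      , (λ eq → corner-injective _ _ (proj₂ (new-injective eq)))
      , (λ eq → side-injective _ _ (proj₂ (edge-injective eq)))
      , λ { 0F → core-equal false (proj₁ u₁) (proj₁ u₂) (proj₁ u₃) , inj₁ (ends-edge e 2F)
          ; 1F → core-equal true (proj₂ (proj₂ (proj₂ (proj₂ u₁)))) (proj₂ (proj₂ (proj₂ (proj₂ u₂))))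
                   (proj₂ (proj₂ (proj₂ (proj₂ u₃)))) , inj₁ (ends-edge e 6F)
          ; 2F → core-equal false (proj₁ (proj₂ (proj₂ (proj₂ u₁)))) (proj₁ (proj₂ (proj₂ (proj₂ u₂))))
                   (proj₁ (proj₂ (proj₂ (proj₂ u₃)))) , inj₁ (ends-edge e 5F) }
      where
      corner : Fin 3 → Fin 4
      corner 0F = 0F
      corner 1F = 1F
      corner 2F = 3F
      side : Fin 3 → Fin 7
      side 0F = 2F
      side 1F = 6F
      side 2F = 5F
      corner-injective : ∀ i j → corner i ≡ corner j → i ≡ j
      corner-injective = from-yes (Fin.all? λ i → Fin.all? λ j → (corner i ≟ corner j) →-dec (i ≟ j))
      side-injective : ∀ i j → side i ≡ side j → i ≡ j
      side-injective = from-yes (Fin.all? λ i → Fin.all? λ j → (side i ≟ side j) →-dec (i ≟ j))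
      core-equal : ∀ b {x} → M₁ x ≡ b → M₂ x ≡ b → M₃ x ≡ b → core G◇ M₁ M₂ M₃ x ≡ true
      core-equal false p₁ p₂ p₃ rewrite p₁ | p₂ | p₃ = refl
      core-equal true  p₁ p₂ _  rewrite p₁ | p₂ = refl

    -- The index 3 stands for length four. The sides of the 4-cycle are numbered `2F` to `5F` in
    -- cyclic order, so side `i` is obtained by a shift by two, with `↑ˡ 1` adjusting the bound to
    -- seven.
    complement-quadrangle : Circuit G◇ (complement3 G◇ M₁ M₂ M₃) 3
    complement-quadrangle = new e , (λ i → edge e (2 ↑ʳ (i ↑ˡ 1)))
      , (λ eq → proj₂ (new-injective eq))
      , (λ eq → Fin.↑ˡ-injective 1 _ _ (Fin.↑ʳ-injective 2 _ _ (proj₂ (edge-injective eq))))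
      , λ { 0F → missed-by-all (proj₁ u₁) (proj₁ u₂) (proj₁ u₃) , inj₁ (ends-edge e 2F)
          ; 1F → missed-by-all (proj₁ (proj₂ u₁)) (proj₁ (proj₂ u₂)) (proj₁ (proj₂ u₃)) , inj₁ (ends-edge e 3F)
          ; 2F → missed-by-all (proj₁ (proj₂ (proj₂ u₁))) (proj₁ (proj₂ (proj₂ u₂))) (proj₁ (proj₂ (proj₂ u₃)))
                 , inj₁ (ends-edge e 4F)
          ; 3F → missed-by-all (proj₁ (proj₂ (proj₂ (proj₂ u₁)))) (proj₁ (proj₂ (proj₂ (proj₂ u₂))))
                   (proj₁ (proj₂ (proj₂ (proj₂ u₃)))) , inj₁ (ends-edge e 5F) }
      where
      missed-by-all : ∀ {x} → M₁ x ≡ false → M₂ x ≡ false → M₃ x ≡ false → complement3 G◇ M₁ M₂ M₃ x ≡ true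
      missed-by-all p₁ p₂ p₃ rewrite p₁ | p₂ | p₃ = refl

-- From the enlarged graph back to the original one

open Diamonds

-- The common part of (4) ⇒ (2) and (5) ⇒ (2): `P` is the condition the statement puts on the
-- 1-factors, and it is applied to `G◇ G` rather than to `G`.
diamond-reduction : (P : (G : Graph) → (M₁ M₂ M₃ : EdgeSet G) → Set) →
  (∀ G {M₁ M₂ M₃} → IsOneFactor (G◇ G) M₁ → IsOneFactor (G◇ G) M₂ → IsOneFactor (G◇ G) M₃ → P (G◇ G) M₁ M₂ M₃ →
    ∀ e → ¬ (contract G M₁ e ≡ true × contract G M₂ e ≡ true × contract G M₃ e ≡ true)) →
  (∀ G → Cubic G → Bridgeless G →
    Σ (EdgeSet G) λ M₁ → Σ (EdgeSet G) λ M₂ → Σ (EdgeSet G) λ M₃ →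
      IsOneFactor G M₁ × IsOneFactor G M₂ × IsOneFactor G M₃ × P G M₁ M₂ M₃) → Stmt2
diamond-reduction P excludes s G cubic bridgeless =
  let M₁ , M₂ , M₃ , F₁ , F₂ , F₃ , p = s (G◇ G) (cubic◇ G cubic) (bridgeless◇ G bridgeless)
  in contract G M₁ , contract G M₂ , contract G M₃
   , contract-oneFactor G M₁ F₁ , contract-oneFactor G M₂ F₂ , contract-oneFactor G M₃ F₃
   , excludes G F₁ F₂ F₃ p

stmt4⇒2 : Stmt4 → Stmt2
stmt4⇒2 = diamond-reduction (λ G M₁ M₂ M₃ → TriangleFree G (core G M₁ M₂ M₃))
  λ G F₁ F₂ F₃ free e common → free (core-triangle G F₁ F₂ F₃ e common)

stmt5⇒2 : Stmt5 → Stmt2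
stmt5⇒2 = diamond-reduction (λ G M₁ M₂ M₃ → Acyclic G (complement3 G M₁ M₂ M₃))
  λ G F₁ F₂ F₃ acyclic e common → acyclic 3 (complement-quadrangle G F₁ F₂ F₃ e common)

theorem3p2 : (Stmt1 ⇔ Stmt2) × (Stmt2 ⇔ Stmt3) × (Stmt3 ⇔ Stmt4) × (Stmt4 ⇔ Stmt5)
theorem3p2 =
    -- Statement (2) is the hub: the other implications are composed from the cycle (2) ⇒ (3) ⇒ (4)
    -- ⇒ (2) and the pair (2) ⇒ (5) ⇒ (2).
    mk⇔ stmt1⇒2 stmt2⇒1
  , mk⇔ stmt2⇒3 (stmt4⇒2 ∘ stmt3⇒4)
  , mk⇔ stmt3⇒4 (stmt2⇒3 ∘ stmt4⇒2)
  , mk⇔ (stmt2⇒5 ∘ stmt4⇒2) (stmt3⇒4 ∘ stmt2⇒3 ∘ stmt5⇒2)
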